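{- Fix any linear ordering of $[n]$. Every row of the forest compatibility matrix $F_n$ is a real linear combination of the rows of $F_n$ indexed by partitions of $[n]$ that are non-crossing with respect to this ordering; that is, the rows corresponding to non-crossing partitions span the row space of $F_n$.
   Context: $[n]=\{1,\dots,n\}$. A forest $G$ on vertex set $[n]\cup V$ (boundary $[n]$) is a representative forest of a partition $\pi$ of $[n]$ if for every block $S\in\pi$ there is a component $C$ of $G$ with $C\cap[n]=S$. Gluing two such graphs means taking their disjoint union and identifying the two copies of each boundary vertex. Partitions $\pi,\rho$ of $[n]$ induce a cycle if the glue of representative forests of $\pi$ and $\rho$ contains a cycle (independent of the representatives). $F_n$ has rows and columns indexed by partitions of $[n]$, $F_n[\pi,\rho]=0$ if $\pi,\rho$ induce a cycle and $1$ otherwise. Two blocks $A,B$ of a partition are crossing with respect to an ordering $<$ if there are $a_1,a_2\in A$, $b_1,b_2\in B$ with $a_1<b_1<a_2<b_2$ or $b_1<a_1<b_2<a_2$; a partition is non-crossing if no two of its blocks cross. -}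

module Defs where

open import Data.Nat using (ℕ; _<_; _≤_)
open import Data.Fin using (Fin; toℕ)
open import Data.Sum using (_⊎_; inj₁; inj₂)
open import Data.Product using (Σ; _×_; _,_; proj₁; proj₂)
open import Data.Unit using (⊤)
open import Data.Empty using (⊥)
open import Data.List using (List; []; _∷_; _++_; [_]; length; map; foldr)
open import Data.List.Relation.Unary.Unique.Propositional using (Unique)
open import Data.Rational using (ℚ; 0ℚ; 1ℚ; _+_)
open import Relation.Binary.PropositionalEquality using (_≡_; _≢_)
open import Relation.Nullary using (¬_)
open import Function.Definitions using (Injective)

-- A partition of [n] = Fin n is encoded by a labelling f : Fin n → Fin n;
-- its blocks are the nonempty fibres of f (i and j in the same block iff f i ≡ f j).
-- Every partition of [n] arises this way (at most n blocks).
Labelling : ℕ → Set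
Labelling n = Fin n → Fin n

record LinearOrder (n : ℕ) : Set where
  field
    pos     : Fin n → Fin n
    pos-inj : Injective _≡_ _≡_ pos

_≺[_]_ : ∀ {n} → Fin n → LinearOrder n → Fin n → Set
a ≺[ o ] b = toℕ (LinearOrder.pos o a) < toℕ (LinearOrder.pos o b)

NonCrossing : ∀ {n} → LinearOrder n → Labelling n → Set
NonCrossing {n} o f =
  (a₁ a₂ b₁ b₂ : Fin n) → f a₁ ≡ f a₂ → f b₁ ≡ f b₂ → f a₁ ≢ f b₁ →
  ¬ ((a₁ ≺[ o ] b₁ × b₁ ≺[ o ] a₂ × a₂ ≺[ o ] b₂)
     ⊎ (b₁ ≺[ o ] a₁ × a₁ ≺[ o ] b₂ × b₂ ≺[ o ] a₂))

-- Glue of the canonical representative forests (one star per block).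
-- Vertices: boundary [n], star centres of π (indexed by label), star centres of ρ.
GlueVertex : ℕ → Set
GlueVertex n = Fin n ⊎ (Fin n ⊎ Fin n)

data GlueAdj {n : ℕ} (π ρ : Labelling n) : GlueVertex n → GlueVertex n → Set where
  bdπ : ∀ i → GlueAdj π ρ (inj₁ i) (inj₂ (inj₁ (π i)))
  πbd : ∀ i → GlueAdj π ρ (inj₂ (inj₁ (π i))) (inj₁ i)
  bdρ : ∀ i → GlueAdj π ρ (inj₁ i) (inj₂ (inj₂ (ρ i)))
  ρbd : ∀ i → GlueAdj π ρ (inj₂ (inj₂ (ρ i))) (inj₁ i)

Chain : ∀ {V : Set} → (V → V → Set) → V → List V → Set
Chain R x []       = ⊤
Chain R x (y ∷ ys) = R x y × Chain R y ys

HasCycle : ∀ {V : Set} → (V → V → Set) → Set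
HasCycle {V} R =
  Σ V λ v → Σ (List V) λ ws →
    (2 ≤ length ws) × Unique (v ∷ ws) × Chain R v (ws ++ [ v ])

InducesCycle : ∀ {n} → Labelling n → Labelling n → Set
InducesCycle π ρ = HasCycle (GlueAdj π ρ)

IsForestMatrix : (n : ℕ) → (Labelling n → Labelling n → ℚ) → Set
IsForestMatrix n F =
  (π ρ : Labelling n) →
    (InducesCycle π ρ → F π ρ ≡ 0ℚ) × (¬ InducesCycle π ρ → F π ρ ≡ 1ℚ)

sumℚ : List ℚ → ℚ
sumℚ = foldr _+_ 0ℚ

{-# OPTIONS --safe #-}
module Submission where

-- Suppressing its boundary vertices, the glue of π and ρ is the bipartite multigraph whose edge i
-- joins the π-block of i to its ρ-block. Cut two blocks of π into four pieces and rejoin the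
-- pieces, in all possible ways, into at most two blocks. For every ρ the signed number of acyclic
-- outcomes vanishes, the sign being the parity of the size of either group: if some piece is
-- connected to no other piece in the glue with all pieces kept apart, moving it to the other
-- group changes the sign but not acyclicity, and if there is no such piece every outcome has a
-- cycle. On rows this reads
--   [AA′|BB′] + [AB|A′B′] + [AB′|A′B] + [AA′BB′] = [A|A′BB′] + [A′|ABB′] + [B|AA′B′] + [B′|AA′B].
--
-- Let now π be non-crossing for an ordering in which x, y are consecutive and lie in different
-- blocks {x} ∪ A and {y} ∪ B. After exchanging x and y in the ordering, all terms of the relation
-- for the pieces {x}, A, {y}, B other than π are non-crossing, so the span of the non-crossing
-- rows does not change. Adjacent exchanges connect all orderings, and π is non-crossing for any
-- ordering that lists its elements block by block.

open import Defs
open import Data.Nat using (ℕ; zero; suc; _<_; _≤_; z≤n; s≤s)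
import Data.Nat.Properties as ℕ
open import Data.Product using (Σ; _×_; _,_; proj₁; proj₂; ∃)
import Data.Product as Product
open import Data.Sum using (_⊎_; inj₁; inj₂; [_,_]′)
import Data.Sum as Sum
import Data.Sum.Properties as Sum
open import Data.Empty using (⊥; ⊥-elim)
open import Data.Unit using (⊤; tt)
open import Data.Fin using (Fin; zero; suc; toℕ)
import Data.Fin.Properties as Fin
open import Data.List using (List; []; _∷_; _++_; [_]; map; allFin)
open import Data.List.Properties using (map-∘; map-cong; map-cong-local; ++-assoc; ++-identityʳ)
open import Data.List.Membership.Propositional using (_∈_; _∉_)
open import Data.List.Membership.Propositional.Properties using (∈-map⁺; ∈-map⁻; ∈-++⁺ˡ; ∈-++⁺ʳ; ∈-++⁻; ∈-allFin; ∈-∃++)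
import Data.List.Membership.DecPropositional as DecMembership
open import Data.List.Relation.Unary.Any using (here; there)
open import Data.List.Relation.Unary.All using (All; []; _∷_)
import Data.List.Relation.Unary.All as All
import Data.List.Relation.Unary.All.Properties as All
open import Data.List.Relation.Unary.AllPairs using (AllPairs; []; _∷_)
open import Data.List.Relation.Unary.Unique.Propositional using (Unique)
open import Data.List.Relation.Unary.Unique.Propositional.Properties using (allFin⁺)
open import Data.List.Relation.Binary.Permutation.Propositional using (_↭_; ↭⇒↭ₛ; refl; prep; swap; trans; ↭-sym; ↭-trans; ↭-reflexive)
open import Data.List.Relation.Binary.Permutation.Propositional.Properties using (∈-resp-↭; shift; map⁺; ++⁺ˡ)
import Data.List.Relation.Binary.Permutation.Setoid.Properties as Permutationₛ
open import Data.Bool using (Bool; true; false; not; if_then_else_)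
import Data.Bool.Properties as Bool
import Data.Rational.Properties as ℚ
open import Data.Rational.Solver using (module +-*-Solver)
open import Data.Fin.Permutation.Components using (transpose; transpose-inverse)
import Data.List.Sort as Sort
open import Data.List.Relation.Unary.Sorted.TotalOrder.Properties using (Sorted⇒AllPairs)
open import Data.Rational using (ℚ; _*_; _≟_; 0ℚ; 1ℚ; _+_; -_; _-_)
open import Function using (_∘_; id)
open import Function.Definitions using (Injective)
open import Relation.Binary using (IsEquivalence; DecidableEquality; DecTotalOrder; tri<; tri≈; tri>)
import Relation.Binary.Construct.On as On
open import Relation.Binary.PropositionalEquality using (setoid; _≗_; module ≡-Reasoning; _≡_; _≢_; refl; sym; cong; cong₂; subst) renaming (trans to ≡-trans)
open import Relation.Binary.Construct.Closure.ReflexiveTransitive using (Star; ε; _◅_; _◅◅_; reverse)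
open import Relation.Nullary using (¬_; Dec; yes; no; contradiction)
open import Relation.Nullary.Decidable using (_×-dec_; _⊎-dec_; ¬?; decidable-stable; toWitness; does; dec-true; dec-false)

private
  variable
    V W : Set
    n : ℕ

-- Connectivity and acyclicity of multigraphs

Edges : Set → Set
Edges V = List (V × V)

-- A walk can be shortened to use the first edge at most once, in one of its two directions.
-- Recursion on the list then makes connectivity decidable.
Conn : Edges V → V → V → Set
Conn []             u v = u ≡ v
Conn ((a , b) ∷ es) u v = Conn es u v ⊎ (Conn es u a × Conn es b v) ⊎ (Conn es u b × Conn es a v)

-- Edges are added from the end of the list, and each has to join two different components, so loops
-- and repeated edges count as cycles.
Acyclic : Edges V → Set
Acyclic []             = ⊤
Acyclic ((a , b) ∷ es) = ¬ Conn es a b × Acyclic es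

conn? : DecidableEquality V → (es : Edges V) → ∀ u v → Dec (Conn es u v)
conn? _≟_ []             u v = u ≟ v
conn? _≟_ ((a , b) ∷ es) u v =
  conn? _≟_ es u v ⊎-dec ((conn? _≟_ es u a ×-dec conn? _≟_ es b v) ⊎-dec (conn? _≟_ es u b ×-dec conn? _≟_ es a v))

acyclic? : DecidableEquality V → (es : Edges V) → Dec (Acyclic es)
acyclic? _≟_ []             = yes tt
acyclic? _≟_ ((a , b) ∷ es) = ¬? (conn? _≟_ es a b) ×-dec acyclic? _≟_ es

conn-refl : ∀ (es : Edges V) {u} → Conn es u u
conn-refl []       = refl
conn-refl (_ ∷ es) = inj₁ (conn-refl es)

conn-sym : ∀ (es : Edges V) {u v} → Conn es u v → Conn es v u
conn-sym []       = sym
conn-sym (_ ∷ es) = Sum.map (conn-sym es)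
  [ (λ (p , q) → inj₂ (conn-sym es q , conn-sym es p)) , (λ (p , q) → inj₁ (conn-sym es q , conn-sym es p)) ]′

-- If both walks use the first edge in the same direction, the part between the two uses is dropped
-- and one use remains; in opposite directions the two uses cancel.
conn-trans : ∀ (es : Edges V) {u v w} → Conn es u v → Conn es v w → Conn es u w
conn-trans []       = ≡-trans
conn-trans (_ ∷ es) {u} {v} {w} = go
  where
  _⨾_ : ∀ {a b c} → Conn es a b → Conn es b c → Conn es a c
  _⨾_ = conn-trans es
  go : Conn (_ ∷ es) u v → Conn (_ ∷ es) v w → Conn (_ ∷ es) u w
  go (inj₁ p)              (inj₁ q)              = inj₁ (p ⨾ q)
  go (inj₁ p)              (inj₂ (inj₁ (q , r))) = inj₂ (inj₁ (p ⨾ q , r))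
  go (inj₁ p)              (inj₂ (inj₂ (q , r))) = inj₂ (inj₂ (p ⨾ q , r))
  go (inj₂ (inj₁ (p , q))) (inj₁ r)              = inj₂ (inj₁ (p , q ⨾ r))
  go (inj₂ (inj₂ (p , q))) (inj₁ r)              = inj₂ (inj₂ (p , q ⨾ r))
  go (inj₂ (inj₁ (p , _))) (inj₂ (inj₁ (_ , r))) = inj₂ (inj₁ (p , r))
  go (inj₂ (inj₁ (p , _))) (inj₂ (inj₂ (_ , r))) = inj₁ (p ⨾ r)
  go (inj₂ (inj₂ (p , _))) (inj₂ (inj₁ (_ , r))) = inj₁ (p ⨾ r)
  go (inj₂ (inj₂ (p , _))) (inj₂ (inj₂ (_ , r))) = inj₂ (inj₂ (p , r))

conn-isEquivalence : (es : Edges V) → IsEquivalence (Conn es)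
conn-isEquivalence es = record { refl = conn-refl es ; sym = conn-sym es ; trans = conn-trans es }

conn-edge : ∀ (es : Edges V) {a b} → (a , b) ∈ es → Conn es a b
conn-edge (_ ∷ es) (here refl) = inj₂ (inj₁ (conn-refl es , conn-refl es))
conn-edge (_ ∷ es) (there e∈)  = inj₁ (conn-edge es e∈)

conn-minimal : {Q : V → V → Set} → IsEquivalence Q → (es : Edges V) →
  (∀ {a b} → (a , b) ∈ es → Q a b) → ∀ {u v} → Conn es u v → Q u v
conn-minimal         eq []             edge refl = IsEquivalence.refl eq
conn-minimal {Q = Q} eq ((a , b) ∷ es) edge      = go
  where
  open IsEquivalence eq using () renaming (sym to Q-sym; trans to Q-trans)
  ih : ∀ {u v} → Conn es u v → Q u v
  ih = conn-minimal eq es (edge ∘ there)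
  go : ∀ {u v} → Conn ((a , b) ∷ es) u v → Q u v
  go (inj₁ p)              = ih p
  go (inj₂ (inj₁ (p , q))) = Q-trans (ih p) (Q-trans (edge (here refl)) (ih q))
  go (inj₂ (inj₂ (p , q))) = Q-trans (ih p) (Q-trans (Q-sym (edge (here refl))) (ih q))

-- Serves to prove vertices disconnected: a set that no edge leaves separates its members from the
-- rest.
conn-invariant : (S : V → Set) (es : Edges V) → (∀ {a b} → (a , b) ∈ es → (S a → S b) × (S b → S a)) →
  ∀ {u v} → Conn es u v → S u → S v
conn-invariant S es inv p = proj₁ (conn-minimal {Q = λ u v → (S u → S v) × (S v → S u)}
  (record { refl = id , id ; sym = λ (f , g) → g , f ; trans = λ (f , g) (h , k) → h ∘ f , g ∘ k }) es inv p)

conn-mono : ∀ (es fs : Edges V) → (∀ {e} → e ∈ es → e ∈ fs) → ∀ {u v} → Conn es u v → Conn fs u v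
conn-mono es fs es⊆fs = conn-minimal (conn-isEquivalence fs) es (conn-edge fs ∘ es⊆fs)

-- The exchange step: a path closed by the second edge through the first one
-- can be rerouted to be closed by the first edge through the second.
acyclic-resp-↭ : {es fs : Edges V} → es ↭ fs → Acyclic es → Acyclic fs
acyclic-resp-↭ refl ac = ac
acyclic-resp-↭ {es = _ ∷ es} {fs = _ ∷ fs} (prep _ p) (na , ac) =
  na ∘ conn-mono fs es (∈-resp-↭ (↭-sym p)) , acyclic-resp-↭ p ac
acyclic-resp-↭ {es = _ ∷ _ ∷ es} {fs = _ ∷ _ ∷ fs} (swap (a , b) (c , d) p) (nab , ncd , ac) =
  exchange ∘ back₁ , nab ∘ inj₁ ∘ back , acyclic-resp-↭ p ac
  where
  back : ∀ {u v} → Conn fs u v → Conn es u v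
  back = conn-mono fs es (∈-resp-↭ (↭-sym p))
  back₁ : ∀ {u v} → Conn ((a , b) ∷ fs) u v → Conn ((a , b) ∷ es) u v
  back₁ = conn-mono ((a , b) ∷ fs) ((a , b) ∷ es) (∈-resp-↭ (prep _ (↭-sym p)))
  exchange : ¬ Conn ((a , b) ∷ es) c d
  exchange (inj₁ q)              = ncd q
  exchange (inj₂ (inj₁ (q , r))) = nab (inj₂ (inj₁ (conn-sym es q , conn-sym es r)))
  exchange (inj₂ (inj₂ (q , r))) = nab (inj₂ (inj₂ (r , q)))
acyclic-resp-↭ (trans p q) ac = acyclic-resp-↭ q (acyclic-resp-↭ p ac)

-- Contracting edges

mapEdges : (V → W) → Edges V → Edges W
mapEdges φ = map (λ (a , b) → φ a , φ b)

module Contraction (φ : V → W) (ls : Edges V)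
  (collapses : ∀ {a b} → (a , b) ∈ ls → φ a ≡ φ b)
  (kernel : ∀ u v → φ u ≡ φ v → Conn ls u v) where

  -- Since `ls` stands at the end of the list, the recursion on `es` ends at `ls` alone, whose
  -- components are exactly the fibres of `φ`.
  conn-project : ∀ es {u v} → Conn (es ++ ls) u v → Conn (mapEdges φ es) (φ u) (φ v)
  conn-project []       = conn-minimal
    (record { refl = refl ; sym = sym ; trans = ≡-trans }) ls collapses
  conn-project (_ ∷ es) = Sum.map ih (Sum.map (Product.map ih ih) (Product.map ih ih))
    where
    ih : ∀ {u v} → Conn (es ++ ls) u v → Conn (mapEdges φ es) (φ u) (φ v)
    ih = conn-project es

  conn-lift : ∀ es {u v} → Conn (mapEdges φ es) (φ u) (φ v) → Conn (es ++ ls) u v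
  conn-lift []       = kernel _ _
  conn-lift (_ ∷ es) = Sum.map ih (Sum.map (Product.map ih ih) (Product.map ih ih))
    where
    ih : ∀ {u v} → Conn (mapEdges φ es) (φ u) (φ v) → Conn (es ++ ls) u v
    ih = conn-lift es

  acyclic-project : ∀ es → Acyclic (es ++ ls) → Acyclic (mapEdges φ es)
  acyclic-project []       _         = tt
  acyclic-project (_ ∷ es) (na , ac) = na ∘ conn-lift es , acyclic-project es ac

  acyclic-lift : Acyclic ls → ∀ es → Acyclic (mapEdges φ es) → Acyclic (es ++ ls)
  acyclic-lift acl []       _         = acl
  acyclic-lift acl (_ ∷ es) (na , ac) = na ∘ conn-project es , acyclic-lift acl es ac

-- The glue as a bipartite multigraph

edge : {U : Set} → (Fin n → U) → Labelling n → Fin n → (U ⊎ Fin n) × (U ⊎ Fin n)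
edge u ρ i = inj₁ (u i) , inj₂ (ρ i)

glueEdges : {U : Set} → (Fin n → U) → Labelling n → Edges (U ⊎ Fin n)
glueEdges u ρ = map (edge u ρ) (allFin _)

∉⇒All≢ : {A : Set} {x : A} {xs : List A} → x ∉ xs → All (x ≢_) xs
∉⇒All≢ {xs = xs} x∉ = All.tabulate λ y∈ x≡y → x∉ (subst (_∈ xs) (sym x≡y) y∈)

unique-resp-↭ : {A : Set} {xs ys : List A} → xs ↭ ys → Unique xs → Unique ys
unique-resp-↭ {A} = Permutationₛ.Unique-resp-↭ (setoid A) ∘ ↭⇒↭ₛ

-- Brings the edge of a chosen `i` to the front, where `Acyclic` says that the remaining edges do
-- not connect its ends.
allFin-split : (i : Fin n) → ∃ λ is → allFin n ↭ i ∷ is × i ∉ is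
allFin-split {n} i with ∈-∃++ (∈-allFin i)
... | ys , zs , eq = ys ++ zs , split , All.All¬⇒¬Any (head≢ (unique-resp-↭ split (allFin⁺ n)))
  where
  split : allFin n ↭ i ∷ ys ++ zs
  split = ↭-trans (↭-reflexive eq) (shift i ys zs)
  head≢ : Unique (i ∷ ys ++ zs) → All (i ≢_) (ys ++ zs)
  head≢ (i≢ ∷ _) = i≢

∈-split : ∀ {i j : Fin n} {is} → allFin n ↭ i ∷ is → j ≢ i → j ∈ is
∈-split {j = j} split j≢i with ∈-resp-↭ split (∈-allFin j)
... | here  j≡i = contradiction j≡i j≢i
... | there j∈  = j∈

-- Walks and simple paths

lastOf : V → List V → V
lastOf v []       = v
lastOf _ (w ∷ ws) = lastOf w ws

chain-∷ʳ : {R : V → V → Set} → ∀ v ws {z} → Chain R v ws → R (lastOf v ws) z → Chain R v (ws ++ [ z ])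
chain-∷ʳ v []       _       r = r , tt
chain-∷ʳ v (w ∷ ws) (s , c) r = s , chain-∷ʳ w ws c r

chain-∷ʳ⁻ : {R : V → V → Set} → ∀ v ws {z} → Chain R v (ws ++ [ z ]) → Chain R v ws × R (lastOf v ws) z
chain-∷ʳ⁻ v []       (r , _) = tt , r
chain-∷ʳ⁻ v (w ∷ ws) (s , c) = Product.map₁ (s ,_) (chain-∷ʳ⁻ w ws c)

lastOf-∷ʳ : ∀ (v : V) ws {z} → lastOf v (ws ++ [ z ]) ≡ z
lastOf-∷ʳ v []       = refl
lastOf-∷ʳ v (w ∷ ws) = lastOf-∷ʳ w ws

lastOf-∈ : ∀ (v : V) ws → lastOf v ws ∈ v ∷ ws
lastOf-∈ v []       = here refl
lastOf-∈ v (w ∷ ws) = there (lastOf-∈ w ws)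

record Path (R : V → V → Set) (u v : V) : Set where
  constructor path
  field
    tail   : List V
    chain  : Chain R u tail
    ends   : lastOf u tail ≡ v
    unique : Unique (u ∷ tail)

suffix : {R : V → V → Set} {w u v : V} (p : Path R u v) → w ∈ u ∷ Path.tail p → Path R w v
suffix p                              (here refl) = p
suffix (path (x ∷ ws) (_ , c) e (_ ∷ q)) (there w∈) = suffix (path ws c e q) w∈

-- When the new first vertex already occurs on the path, the closed part is cut off by starting from
-- that occurrence.
star⇒path : DecidableEquality V → {R : V → V → Set} {u v : V} → Star R u v → Path R u v
star⇒path _≟_ ε = path [] tt refl ([] ∷ [])
star⇒path _≟_ {u = u} (r ◅ s) with star⇒path _≟_ s
... | p with DecMembership._∈?_ _≟_ u (_ ∷ Path.tail p)
...   | yes u∈ = suffix p u∈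
...   | no  u∉ = path (_ ∷ Path.tail p) (r , Path.chain p) (Path.ends p) (∉⇒All≢ u∉ ∷ Path.unique p)

-- Cycles of the glue against acyclicity of the multigraph

_≟ⱽ_ : DecidableEquality (GlueVertex n)
_≟ⱽ_ = Sum.≡-dec Fin._≟_ (Sum.≡-dec Fin._≟_ Fin._≟_)

module Glue (π ρ : Labelling n) where

  Avoiding : Fin n → GlueVertex n → GlueVertex n → Set
  Avoiding i v w = GlueAdj π ρ v w × inj₁ i ≢ v × inj₁ i ≢ w

  adj-sym : ∀ {v w} → GlueAdj π ρ v w → GlueAdj π ρ w v
  adj-sym (bdπ i) = πbd i
  adj-sym (πbd i) = bdπ i
  adj-sym (bdρ i) = ρbd i
  adj-sym (ρbd i) = bdρ i

  -- An edge `j` of the multigraph is the walk from centre to centre through the boundary vertex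
  -- `j`, and `j` differs from `i` because `i` is not in `is`.
  conn⇒star : ∀ {i is} → i ∉ is → ∀ {u v} → Conn (map (edge π ρ) is) u v → Star (Avoiding i) (inj₂ u) (inj₂ v)
  conn⇒star {i} {is} i∉ = conn-minimal
    (record { refl = ε ; sym = reverse (λ (r , p , q) → adj-sym r , q , p) ; trans = _◅◅_ }) (map (edge π ρ) is)
    λ e∈ → detour (∈-map⁻ (edge π ρ) e∈)
    where
    detour : ∀ {a b} → ∃ (λ j → j ∈ is × (a , b) ≡ edge π ρ j) → Star (Avoiding i) (inj₂ a) (inj₂ b)
    detour (j , j∈ , refl) = (πbd j , (λ ()) , i≢j) ◅ (bdρ j , i≢j , λ ()) ◅ ε
      where
      i≢j : inj₁ i ≢ inj₁ j
      i≢j refl = i∉ j∈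

  avoiding⇒chain : ∀ {i} v ws → Chain (Avoiding i) v ws → Chain (GlueAdj π ρ) v ws × All (inj₁ i ≢_) ws
  avoiding⇒chain v []       _                  = tt , []
  avoiding⇒chain v (w ∷ ws) ((r , _ , i≢w) , c) = Product.map (r ,_) (i≢w ∷_) (avoiding⇒chain w ws c)

  path⇒cycle : ∀ {i} → Path (Avoiding i) (inj₂ (inj₁ (π i))) (inj₂ (inj₂ (ρ i))) → InducesCycle π ρ
  -- The ends are centres of different forests, so the path has a step and the cycle closed through
  -- `i` has at least three vertices.
  path⇒cycle     (path []       _ () _)
  path⇒cycle {i} (path (w ∷ ws) c e u) with avoiding⇒chain _ (w ∷ ws) c
  ... | c′ , i≢ = inj₁ i , _ ∷ w ∷ ws , s≤s (s≤s z≤n) , ((λ ()) ∷ i≢) ∷ u ,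
        bdπ i , chain-∷ʳ _ (w ∷ ws) c′ (subst (λ z → GlueAdj π ρ z (inj₁ i)) (sym e) (ρbd i))

  ¬cycle⇒acyclic : ¬ InducesCycle π ρ → Acyclic (glueEdges π ρ)
  ¬cycle⇒acyclic ¬cyc = go (allFin _) (allFin⁺ _)
    where
    go : ∀ is → Unique is → Acyclic (map (edge π ρ) is)
    go []       _        = tt
    go (i ∷ is) (i≢ ∷ u) = (¬cyc ∘ path⇒cycle ∘ star⇒path _≟ⱽ_ ∘ conn⇒star (λ i∈ → All.lookup i≢ i∈ refl)) , go is u

  -- Boundary vertices move to their π-centre, so a step between `j` and `π j` becomes trivial and a
  -- step between `j` and `ρ j` becomes the edge of `j`.
  label : GlueVertex n → Fin n ⊎ Fin n
  label (inj₁ i) = inj₁ (π i)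
  label (inj₂ l) = l

  chain⇒conn : ∀ {i} es → (∀ j → i ≢ j → edge π ρ j ∈ es) → ∀ v ws → Chain (GlueAdj π ρ) v ws →
    All (inj₁ i ≢_) (v ∷ ws) → Conn es (label v) (label (lastOf v ws))
  chain⇒conn es inc v []       _       _              = conn-refl es
  chain⇒conn es inc v (w ∷ ws) (r , c) (i≢v ∷ i≢w ∷ a) =
    conn-trans es (step r i≢v i≢w) (chain⇒conn es inc w ws c (i≢w ∷ a))
    where
    step : ∀ {v w} → GlueAdj π ρ v w → inj₁ _ ≢ v → inj₁ _ ≢ w → Conn es (label v) (label w)
    step (bdπ j) _   _   = conn-refl es
    step (πbd j) _   _   = conn-refl es
    step (bdρ j) i≢j _   = conn-edge es (inc j (i≢j ∘ cong inj₁))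
    step (ρbd j) _   i≢j = conn-sym es (conn-edge es (inc j (i≢j ∘ cong inj₁)))

  -- The only neighbours of `i` are its two centres. A walk from one to the other that avoids `i`
  -- connects the ends of the edge of `i` by other edges.
  ends⇒¬acyclic : ∀ i {v} ws → GlueAdj π ρ (inj₁ i) v → Chain (GlueAdj π ρ) v ws →
    GlueAdj π ρ (inj₁ i) (lastOf v ws) → v ≢ lastOf v ws → All (inj₁ i ≢_) (v ∷ ws) → ¬ Acyclic (glueEdges π ρ)
  ends⇒¬acyclic i {v} ws r c s v≢ a ac with allFin-split i
  ... | is , all↭ , _ = proj₁ (acyclic-resp-↭ (map⁺ (edge π ρ) all↭) ac) (ends r s v≢ (chain⇒conn _ inc v ws c a))
    where
    es = map (edge π ρ) is
    inc : ∀ j → i ≢ j → edge π ρ j ∈ es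
    inc j i≢j = ∈-map⁺ (edge π ρ) (∈-split all↭ (i≢j ∘ sym))
    ends : ∀ {v w} → GlueAdj π ρ (inj₁ i) v → GlueAdj π ρ (inj₁ i) w → v ≢ w → Conn es (label v) (label w) →
      Conn es (inj₁ (π i)) (inj₂ (ρ i))
    ends (bdπ _) (bdπ _) v≢w _ = contradiction refl v≢w
    ends (bdπ _) (bdρ _) _   p = p
    ends (bdρ _) (bdπ _) _   p = conn-sym es p
    ends (bdρ _) (bdρ _) v≢w _ = contradiction refl v≢w

  cycle⇒¬acyclic : InducesCycle π ρ → ¬ Acyclic (glueEdges π ρ)
  cycle⇒¬acyclic (inj₁ i , w ∷ x ∷ ws , _ , i≢ ∷ w≢ ∷ _ , r , c) with chain-∷ʳ⁻ w (x ∷ ws) c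
  ... | c′ , s = ends⇒¬acyclic i (x ∷ ws) r c′ (adj-sym s) (All.lookup w≢ (lastOf-∈ x ws)) i≢
  cycle⇒¬acyclic (inj₂ v , inj₂ w ∷ _ , _ , _ , () , _)
  -- A cycle that starts at a centre is rotated by one vertex to start at a boundary vertex.
  cycle⇒¬acyclic (inj₂ v , inj₁ i ∷ x ∷ ws , _ , (_ ∷ v≢) ∷ i≢ ∷ _ , r , s , c) =
    ends⇒¬acyclic i (ws ++ [ inj₂ v ]) s c (subst (GlueAdj π ρ (inj₁ i)) (sym last≡v) (adj-sym r))
      (λ x≡last → All.lookup v≢ (here refl) (sym (≡-trans x≡last last≡v))) (All.++⁺ i≢ ((λ ()) ∷ []))
    where
    last≡v : lastOf x (ws ++ [ inj₂ v ]) ≡ inj₂ v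
    last≡v = lastOf-∷ʳ x ws
  cycle⇒¬acyclic (inj₁ _ , _ ∷ [] , s≤s () , _)
  cycle⇒¬acyclic (inj₂ _ , inj₁ _ ∷ [] , s≤s () , _)

-- The four-piece relation

Colouring : Set
Colouring = Fin 4 → Bool

-- The pieces are, in this order, {x}, {y}, the rest of the block of y and the rest of the block of x.
colouring : (x y b a : Bool) → Colouring
colouring x y b a zero                   = x
colouring x y b a (suc zero)             = y
colouring x y b a (suc (suc zero))       = b
colouring x y b a (suc (suc (suc zero))) = a

third : ∀ (p q : Fin 4) → ∃ λ r → r ≢ p × r ≢ q
third = toWitness {a? = Fin.all? λ p → Fin.all? λ q → Fin.any? λ r → ¬? (r Fin.≟ p) ×-dec ¬? (r Fin.≟ q)} tt

≢-≢⇒≡ : ∀ {a b d : Bool} → a ≢ b → a ≢ d → b ≡ d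
≢-≢⇒≡ a≢b a≢d = ≡-trans (Bool.¬-not (a≢b ∘ sym)) (sym (Bool.¬-not (a≢d ∘ sym)))

-- The forest matrix as an indicator of acyclicity

indicator : {A : Set} → Dec A → ℚ
indicator d = if does d then 1ℚ else 0ℚ

indicator-yes : {A : Set} (d : Dec A) → A → indicator d ≡ 1ℚ
indicator-yes d a = cong (λ b → if b then 1ℚ else 0ℚ) (dec-true d a)

indicator-no : {A : Set} (d : Dec A) → ¬ A → indicator d ≡ 0ℚ
indicator-no d ¬a = cong (λ b → if b then 1ℚ else 0ℚ) (dec-false d ¬a)

indicator-cong : {A B : Set} (d : Dec A) (e : Dec B) → (A → B) → (B → A) → indicator d ≡ indicator e
indicator-cong (yes a) e f g = sym (indicator-yes e (f a))
indicator-cong (no ¬a) e f g = sym (indicator-no e (¬a ∘ g))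

forest : Labelling n → Labelling n → ℚ
forest π ρ = indicator (acyclic? (Sum.≡-dec Fin._≟_ Fin._≟_) (glueEdges π ρ))

forestMatrix-unique : ∀ {F} → IsForestMatrix n F → ∀ π ρ → F π ρ ≡ forest π ρ
forestMatrix-unique isF π ρ with acyclic? (Sum.≡-dec Fin._≟_ Fin._≟_) (glueEdges π ρ)
... | yes ac = proj₂ (isF π ρ) (λ cyc → Glue.cycle⇒¬acyclic π ρ cyc ac)
-- No cycle is constructed. Equality of rationals is decidable, so it suffices that a nonzero entry
-- would exclude cycles and thereby make the glue acyclic.
... | no ¬ac = decidable-stable (_ ≟ 0ℚ) λ F≢0 → ¬ac (Glue.¬cycle⇒acyclic π ρ (F≢0 ∘ proj₁ (isF π ρ)))

forest-cong : {π π′ : Labelling n} → π ≗ π′ → ∀ ρ → forest π ρ ≡ forest π′ ρ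
forest-cong π≗π′ ρ = cong (indicator ∘ acyclic? _)
  (map-cong (λ i → cong (λ l → inj₁ l , inj₂ (ρ i)) (π≗π′ i)) (allFin _))

-- An injective renaming of the blocks is a contraction of the empty list of edges.
forest-relabel : (ψ : Fin n → Fin n) → Injective _≡_ _≡_ ψ → ∀ π ρ → forest (ψ ∘ π) ρ ≡ forest π ρ
forest-relabel {n} ψ inj π ρ = indicator-cong (acyclic? _ _) (acyclic? _ _)
  (λ ac → subst Acyclic (++-identityʳ _) (acyclic-lift tt (glueEdges π ρ) (subst Acyclic (map-∘ (allFin n)) ac)))
  (λ ac → subst Acyclic (sym (map-∘ (allFin n))) (acyclic-project (glueEdges π ρ) (subst Acyclic (sym (++-identityʳ _)) ac)))
  where
  ψ₁-injective : ∀ (u v : Fin n ⊎ Fin n) → Sum.map₁ ψ u ≡ Sum.map₁ ψ v → u ≡ v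
  ψ₁-injective (inj₁ a) (inj₁ b) eq   = cong inj₁ (inj (Sum.inj₁-injective eq))
  ψ₁-injective (inj₂ a) (inj₂ .a) refl = refl
  open Contraction (Sum.map₁ ψ) [] (λ ()) ψ₁-injective

transpose-injective : (i j : Fin n) → Injective _≡_ _≡_ (transpose i j)
transpose-injective i j eq =
  ≡-trans (sym (transpose-inverse j i)) (≡-trans (cong (transpose j i) eq) (transpose-inverse j i))

-- The right side has the form that `row` takes on a list of seven terms.
solve-for-first : ∀ s a b c d e f g → s + a + b + c ≡ d + e + f + g →
  s ≡ sumℚ ((- 1ℚ * a) ∷ (- 1ℚ * b) ∷ (- 1ℚ * c) ∷ (1ℚ * d) ∷ (1ℚ * e) ∷ (1ℚ * f) ∷ (1ℚ * g) ∷ [])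
solve-for-first s a b c d e f g eq = begin
  s                         ≡⟨ solve 4 (λ s a b c → s := (s :+ a :+ b :+ c) :- (a :+ b :+ c)) refl s a b c ⟩
  s + a + b + c - (a + b + c) ≡⟨ cong (_- (a + b + c)) eq ⟩
  d + e + f + g - (a + b + c)
    ≡⟨ solve 7 (λ a b c d e f g → (d :+ e :+ f :+ g) :- (a :+ b :+ c) :=
         con (- 1ℚ) :* a :+ (con (- 1ℚ) :* b :+ (con (- 1ℚ) :* c :+
           (con 1ℚ :* d :+ (con 1ℚ :* e :+ (con 1ℚ :* f :+ (con 1ℚ :* g :+ con 0ℚ)))))))
         refl a b c d e f g ⟩
  sumℚ ((- 1ℚ * a) ∷ (- 1ℚ * b) ∷ (- 1ℚ * c) ∷ (1ℚ * d) ∷ (1ℚ * e) ∷ (1ℚ * f) ∷ (1ℚ * g) ∷ []) ∎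
  where
  open ≡-Reasoning
  open +-*-Solver

-- The fourth piece keeps its colour: up to exchanging the two colours, flipping it flips the other three.
Balanced : (Bool → Bool → Bool → ℚ) → Set
Balanced w =
  (∀ x y b → w x y b ≡ w (not x) y b) ⊎ (∀ x y b → w x y b ≡ w x (not y) b) ⊎
  (∀ x y b → w x y b ≡ w x y (not b)) ⊎ (∀ x y b → w x y b ≡ w (not x) (not y) (not b))

-- The left side collects the arguments with an odd number of `true`. Flipping one or all three
-- changes this parity, so each invariance pairs equal terms of the two sides.
balanced-sum : ∀ w → Balanced w →
  w true false false + w false true false + w false false true + w true true true ≡
  w false true true + w true false true + w true true false + w false false false
balanced-sum w (inj₁ eq)
  rewrite eq true false false | eq false true false | eq false false true | eq true true true =
    solve 4 (λ a b c d → a :+ b :+ c :+ d := d :+ c :+ b :+ a) refl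
      (w false false false) (w true true false) (w true false true) (w false true true)
  where open +-*-Solver
balanced-sum w (inj₂ (inj₁ eq))
  rewrite eq true false false | eq false true false | eq false false true | eq true true true =
    solve 4 (λ a b c d → a :+ b :+ c :+ d := c :+ d :+ a :+ b) refl
      (w true true false) (w false false false) (w false true true) (w true false true)
  where open +-*-Solver
balanced-sum w (inj₂ (inj₂ (inj₁ eq)))
  rewrite eq true false false | eq false true false | eq false false true | eq true true true =
    solve 4 (λ a b c d → a :+ b :+ c :+ d := b :+ a :+ d :+ c) refl
      (w true false true) (w false true true) (w false false false) (w true true false)
  where open +-*-Solver
balanced-sum w (inj₂ (inj₂ (inj₂ eq)))
  rewrite eq true false false | eq false true false | eq false false true | eq true true true = refl

-- Painting four pieces with two labels

module Pieces (P : Fin n → Fin 4 ⊎ Fin n) (α β : Fin n) (P≢α : ∀ i → P i ≢ inj₂ α) (P≢β : ∀ i → P i ≢ inj₂ β) where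

  colour : Bool → Fin n
  colour true  = α
  colour false = β

  -- `P` gives the piece of an element of the cut blocks and the label of any other element. No
  -- uncut block is labelled `α` or `β`, so these are free for the two groups.
  paint : Colouring → Labelling n
  paint c = [ colour ∘ c , id ]′ ∘ P

  complement : ∀ c i → paint (not ∘ c) i ≡ transpose α β (paint c i)
  complement c i with P i | P≢α i | P≢β i
  ... | inj₁ p | _   | _ with c p
  ...   | true  rewrite dec-true (α Fin.≟ α) refl = refl
  ...   | false with β Fin.≟ α
  ...     | yes β≡α = sym β≡α
  ...     | no  _ rewrite dec-true (β Fin.≟ β) refl = refl
  complement c i | inj₂ l | ≢α | ≢β
    rewrite dec-false (l Fin.≟ α) (≢α ∘ cong inj₂) | dec-false (l Fin.≟ β) (≢β ∘ cong inj₂) = refl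

  module _ (ρ : Labelling n) where

    Vertex : Set
    Vertex = (Fin 4 ⊎ Fin n) ⊎ Fin n

    piece : Fin 4 → Vertex
    piece = inj₁ ∘ inj₁

    centre : Bool → Vertex
    centre = inj₁ ∘ inj₂ ∘ colour

    -- The glue with all pieces kept apart. The centres of `α` and `β` are isolated in it, and a
    -- colouring acts only through the links.
    H : Edges Vertex
    H = glueEdges P ρ

    link : Colouring → Fin 4 → Vertex × Vertex
    link c p = piece p , centre (c p)

    links : Colouring → List (Fin 4) → Edges Vertex
    links c = map (link c)

    -- Contracting the links turns H with its links into the painted glue.
    φ : Colouring → Vertex → Fin n ⊎ Fin n
    φ c = Sum.map₁ [ colour ∘ c , id ]′

    -- Each piece is a leaf: no link but its own touches it.
    links-acyclic : ∀ c ps → Unique ps → Acyclic (links c ps)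
    links-acyclic c []       _         = tt
    links-acyclic c (p ∷ ps) (p≢ ∷ u) =
      (λ con → piece≢centre (conn-invariant (_≡ piece p) (links c ps) off con refl)) , links-acyclic c ps u
      where
      piece≢centre : centre (c p) ≢ piece p
      piece≢centre ()
      off : ∀ {a b} → (a , b) ∈ links c ps → (a ≡ piece p → b ≡ piece p) × (b ≡ piece p → a ≡ piece p)
      off ab∈ with ∈-map⁻ (link c) ab∈
      ... | q , q∈ , refl = (λ { refl → contradiction refl (All.lookup p≢ q∈) }) , λ ()

    module Contract (c : Colouring) where

      ls : Edges Vertex
      ls = links c (allFin 4)

      collapses : ∀ {a b} → (a , b) ∈ ls → φ c a ≡ φ c b
      collapses ab∈ with ∈-map⁻ (link c) ab∈
      ... | q , q∈ , refl = refl

      section : Fin n ⊎ Fin n → Vertex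
      section = Sum.map₁ inj₂

      to-section : ∀ u → Conn ls u (section (φ c u))
      to-section (inj₁ (inj₁ p)) = conn-edge ls (∈-map⁺ (link c) (∈-allFin p))
      to-section (inj₁ (inj₂ l)) = conn-refl ls
      to-section (inj₂ r)        = conn-refl ls

      kernel : ∀ u v → φ c u ≡ φ c v → Conn ls u v
      kernel u v eq = conn-trans ls (to-section u)
        (subst (λ w → Conn ls (section w) v) (sym eq) (conn-sym ls (to-section v)))

      open Contraction (φ c) ls collapses kernel public

    linked : Colouring → Edges Vertex
    linked c = H ++ links c (allFin 4)

    painted≡ : ∀ c → mapEdges (φ c) H ≡ glueEdges (paint c) ρ
    painted≡ c = sym (map-∘ (allFin n))

    linked⇒painted : ∀ c → Acyclic (linked c) → Acyclic (glueEdges (paint c) ρ)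
    linked⇒painted c ac = subst Acyclic (painted≡ c) (Contract.acyclic-project c H ac)

    painted⇒linked : ∀ c → Acyclic (glueEdges (paint c) ρ) → Acyclic (linked c)
    painted⇒linked c ac =
      Contract.acyclic-lift c (links-acyclic c (allFin 4) (allFin⁺ 4)) H (subst Acyclic (sym (painted≡ c)) ac)

    linked-split : ∀ c {p ps} → allFin 4 ↭ p ∷ ps → linked c ↭ link c p ∷ H ++ links c ps
    linked-split c {p} {ps} split = ↭-trans (++⁺ˡ H (map⁺ (link c) split)) (shift (link c p) H (links c ps))

    Mate : Fin 4 → Fin 4 → Set
    Mate p q = q ≢ p × Conn H (piece p) (piece q)

    Isolated : Fin 4 → Set
    Isolated p = ¬ ∃ (Mate p)

    centre-isolated : ∀ {p} k → ¬ Conn H (piece p) (centre k)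
    centre-isolated {p} k con = piece≢centre (conn-invariant (_≡ centre k) H off (conn-sym H con) refl)
      where
      piece≢centre : piece p ≢ centre k
      piece≢centre ()
      P≢ : ∀ k i → P i ≢ inj₂ (colour k)
      P≢ true  = P≢α
      P≢ false = P≢β
      off : ∀ {a b} → (a , b) ∈ H → (a ≡ centre k → b ≡ centre k) × (b ≡ centre k → a ≡ centre k)
      off ab∈ with ∈-map⁻ (edge P ρ) ab∈
      ... | i , i∈ , refl = (λ eq → contradiction (Sum.inj₁-injective eq) (P≢ k i)) , λ ()

    -- Recolouring p keeps the link at p from closing a cycle, because the
    -- component of p in H reaches the other links neither at a piece nor at a centre.
    flip : ∀ {p} → Isolated p → ∀ c c′ → (∀ q → q ≢ p → c q ≡ c′ q) → Acyclic (linked c) → Acyclic (linked c′)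
    flip {p} iso c c′ agree ac with allFin-split p
    ... | ps , split , p∉ = acyclic-resp-↭ (↭-sym (linked-split c′ split)) (no-cycle , rest-acyclic)
      where
      rest≡ : links c ps ≡ links c′ ps
      rest≡ = map-cong-local (All.tabulate λ {q} q∈ → cong (λ k → piece q , centre k) (agree q (λ { refl → p∉ q∈ })))
      rest-acyclic : Acyclic (H ++ links c′ ps)
      rest-acyclic = subst (λ ls → Acyclic (H ++ ls)) rest≡ (proj₂ (acyclic-resp-↭ (linked-split c split) ac))
      off : ∀ {a b} → (a , b) ∈ H ++ links c′ ps →
        (Conn H (piece p) a → Conn H (piece p) b) × (Conn H (piece p) b → Conn H (piece p) a)
      off ab∈ with ∈-++⁻ H ab∈
      ... | inj₁ ab∈H = (λ con → conn-trans H con (conn-edge H ab∈H)) ,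
                        (λ con → conn-trans H con (conn-sym H (conn-edge H ab∈H)))
      ... | inj₂ ab∈L with ∈-map⁻ (link c′) ab∈L
      ...   | q , q∈ , refl = (λ con → contradiction (q , (λ { refl → p∉ q∈ }) , con) iso) ,
                              λ con → contradiction con (centre-isolated (c′ q))
      no-cycle : ¬ Conn (H ++ links c′ ps) (piece p) (centre (c′ p))
      no-cycle con = centre-isolated (c′ p) (conn-invariant (Conn H (piece p)) (H ++ links c′ ps) off con (conn-refl H))

    module Mated (c : Colouring) (ac : Acyclic (linked c)) where

      -- Isolates the use of acyclicity at the link of `p`: `H` and the other three links together
      -- must not connect the ends of that link.
      no-detour : ∀ p → ∃ λ es → ¬ Conn es (piece p) (centre (c p)) ×
        (∀ {u v} → Conn H u v → Conn es u v) × (∀ {q} → q ≢ p → Conn es (piece q) (centre (c q)))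
      no-detour p with allFin-split p
      ... | ps , split , _ = es , proj₁ (acyclic-resp-↭ (linked-split c split) ac) , conn-mono H es ∈-++⁺ˡ ,
          λ q≢p → conn-edge es (∈-++⁺ʳ H (∈-map⁺ (link c) (∈-split split q≢p)))
        where es = H ++ links c ps

      -- Mates of equal colour would lie on a cycle through their common centre.
      mate-colours : ∀ {p q} → Mate p q → c p ≢ c q
      mate-colours {p} {q} (q≢p , con) cp≡cq with no-detour p
      ... | es , ¬con , H⊆ , via = ¬con (conn-trans es (H⊆ con) (subst (Conn es (piece q) ∘ centre) (sym cp≡cq) (via q≢p)))

      -- A cycle would run from `p` through `H` to `q`, over the common centre to `s`, through `H`
      -- to `r`, and over the other common centre back to `p`.
      aligned : ∀ {p q r s} → Mate p q → Conn H (piece r) (piece s) → r ≢ p → s ≢ p → c p ≡ c r → c q ≡ c s → ⊥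
      aligned {p} {q} {r} {s} (q≢p , pq) rs r≢p s≢p cp≡cr cq≡cs with no-detour p
      ... | es , ¬con , H⊆ , via = ¬con (H⊆ pq ⨾ (subst (Conn es (piece q) ∘ centre) cq≡cs (via q≢p) ⨾
              (conn-sym es (via s≢p) ⨾ (conn-sym es (H⊆ rs) ⨾ subst (Conn es (piece r) ∘ centre) (sym cp≡cr) (via r≢p)))))
        where
        _⨾_ : ∀ {u v w} → Conn es u v → Conn es v w → Conn es u w
        _⨾_ = conn-trans es

      -- Two different mates of `p` would be mates of each other, and three pairwise mated pieces
      -- would need three colours.
      mate-unique : ∀ {p q r} → Mate p q → Mate p r → r ≡ q
      mate-unique {p} {q} {r} pq@(_ , con) pr@(_ , con′) with r Fin.≟ q
      ... | yes r≡q = r≡q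
      ... | no  r≢q = contradiction (≢-≢⇒≡ (mate-colours pq) (mate-colours pr))
              (mate-colours (r≢q , conn-trans H (conn-sym H con) con′))

      -- The mates would form two pairs, each showing both colours. Matching the pairs colour by
      -- colour gives the configuration excluded by `aligned`.
      ¬all-mated : ¬ (∀ p → ∃ (Mate p))
      ¬all-mated mate with mate zero
      ... | q , pq@(q≢p , con) with third zero q
      ...   | r , r≢p , r≢q with mate r
      ...     | s , rs@(s≢r , con′) with s Fin.≟ zero
      ...       | yes refl = r≢q (mate-unique pq (r≢p , conn-sym H con′))
      ...       | no  s≢p with c zero Bool.≟ c r
      ...         | yes p≡r = aligned pq con′ r≢p s≢p p≡r
                      (≢-≢⇒≡ (mate-colours pq) (subst (_≢ c s) (sym p≡r) (mate-colours rs)))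
      ...         | no  p≢r = aligned pq (conn-sym H con′) s≢p r≢p
                      (≢-≢⇒≡ (p≢r ∘ sym) (mate-colours rs)) (≢-≢⇒≡ (mate-colours pq) p≢r)

    weight : Colouring → ℚ
    weight c = forest (paint c) ρ

    weight-flip : ∀ {p} → Isolated p → ∀ c c′ → (∀ q → q ≢ p → c q ≡ c′ q) → weight c ≡ weight c′
    weight-flip iso c c′ agree = indicator-cong (acyclic? _ _) (acyclic? _ _)
      (linked⇒painted c′ ∘ flip iso c c′ agree ∘ painted⇒linked c)
      (linked⇒painted c ∘ flip iso c′ c (λ q q≢p → sym (agree q q≢p)) ∘ painted⇒linked c′)

    weight-mated : (∀ p → ∃ (Mate p)) → ∀ c → weight c ≡ 0ℚ
    weight-mated mate c = indicator-no (acyclic? _ (glueEdges (paint c) ρ))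
      λ ac → Mated.¬all-mated c (painted⇒linked c ac) mate

    weight-complement : ∀ c → weight (not ∘ c) ≡ weight c
    weight-complement c = ≡-trans (forest-cong (complement c) ρ)
      (forest-relabel (transpose α β) (transpose-injective α β) (paint c) ρ)

    mates? : ∀ p → Dec (∃ (Mate p))
    mates? p = Fin.any? λ q →
      ¬? (q Fin.≟ p) ×-dec conn? (Sum.≡-dec (Sum.≡-dec Fin._≟_ Fin._≟_) Fin._≟_) H (piece p) (piece q)

    balanced : Balanced (λ x y b → weight (colouring x y b true))
    balanced with ¬? (mates? zero) | ¬? (mates? (suc zero))
      | ¬? (mates? (suc (suc zero))) | ¬? (mates? (suc (suc (suc zero))))
    ... | yes iso | _ | _ | _ = inj₁ λ x y b → weight-flip iso _ _ λ
            { zero q≢ → contradiction refl q≢ ; (suc zero) _ → refl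
            ; (suc (suc zero)) _ → refl ; (suc (suc (suc zero))) _ → refl }
    ... | _ | yes iso | _ | _ = inj₂ (inj₁ λ x y b → weight-flip iso _ _ λ
            { zero _ → refl ; (suc zero) q≢ → contradiction refl q≢
            ; (suc (suc zero)) _ → refl ; (suc (suc (suc zero))) _ → refl })
    ... | _ | _ | yes iso | _ = inj₂ (inj₂ (inj₁ λ x y b → weight-flip iso _ _ λ
            { zero _ → refl ; (suc zero) _ → refl
            ; (suc (suc zero)) q≢ → contradiction refl q≢ ; (suc (suc (suc zero))) _ → refl }))
    -- Complementing all colours and then restoring that of the fourth piece flips exactly the other
    -- three.
    ... | _ | _ | _ | yes iso = inj₂ (inj₂ (inj₂ λ x y b → ≡-trans (sym (weight-complement _)) (weight-flip iso _ _ λ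
            { zero _ → refl ; (suc zero) _ → refl
            ; (suc (suc zero)) _ → refl ; (suc (suc (suc zero))) q≢ → contradiction refl q≢ })))
    -- All weights vanish here, so any of the four invariances can be chosen.
    ... | no i₀ | no i₁ | no i₂ | no i₃ = inj₁ λ x y b → ≡-trans (weight-mated mate _) (sym (weight-mated mate _))
      where
      mate : ∀ p → ∃ (Mate p)
      mate zero                   = decidable-stable (mates? _) i₀
      mate (suc zero)             = decidable-stable (mates? _) i₁
      mate (suc (suc zero))       = decidable-stable (mates? _) i₂
      mate (suc (suc (suc zero))) = decidable-stable (mates? _) i₃

  crossing-relation : ∀ ρ → let w = λ x y b → forest (paint (colouring x y b true)) ρ in
    w true false false ≡ sumℚ
      ((- 1ℚ * w false true false) ∷ (- 1ℚ * w false false true) ∷ (- 1ℚ * w true true true) ∷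
       (1ℚ * w false true true) ∷ (1ℚ * w true false true) ∷ (1ℚ * w true true false) ∷ (1ℚ * w false false false) ∷ [])
  crossing-relation ρ = solve-for-first (w true false false) (w false true false) (w false false true) (w true true true)
    (w false true true) (w true false true) (w true true false) (w false false false)
    (balanced-sum w (balanced ρ))
    where
    w : Bool → Bool → Bool → ℚ
    w x y b = forest (paint (colouring x y b true)) ρ

-- Exchanging adjacent elements of the ordering

-- One alternating pattern suffices, since the other arises by exchanging the two blocks. Ranks in ℕ
-- allow positions in a list to serve as the order.
NonCrossingBy : (Fin n → ℕ) → Labelling n → Set
NonCrossingBy r f = ∀ a b a′ b′ → r a < r b → r b < r a′ → r a′ < r b′ → f a ≡ f a′ → f b ≡ f b′ → f a ≡ f b

nonCrossingBy-cong : ∀ (r : Fin n → ℕ) {f g} → f ≗ g → NonCrossingBy r f → NonCrossingBy r g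
nonCrossingBy-cong r f≗g nc a b a′ b′ ab ba′ a′b′ ga≡ gb≡ = ≡-trans (sym (f≗g _))
  (≡-trans (nc _ _ _ _ ab ba′ a′b′
    (≡-trans (f≗g _) (≡-trans ga≡ (sym (f≗g _)))) (≡-trans (f≗g _) (≡-trans gb≡ (sym (f≗g _))))) (f≗g _))

Near : ℕ → ℕ → Set
Near k i = i ≡ k ⊎ i ≡ suc k

-- A position other than `k` and `suc k` lies on the same side of both.
below-near : ∀ {k m i j} → ¬ Near k m → Near k i → Near k j → m < i → m < j
below-near {k} {m} m∉ near-i near-j m<i = ℕ.<-≤-trans m<k (k≤ near-j)
  where
  k≤ : ∀ {j} → Near k j → k ≤ j
  k≤ (inj₁ refl) = ℕ.≤-refl
  k≤ (inj₂ refl) = ℕ.n≤1+n k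
  ≤1+k : ∀ {i} → Near k i → i ≤ suc k
  ≤1+k (inj₁ refl) = ℕ.n≤1+n k
  ≤1+k (inj₂ refl) = ℕ.≤-refl
  m<k : m < k
  m<k = ℕ.≤∧≢⇒< (ℕ.≤-pred (ℕ.≤-trans m<i (≤1+k near-i))) (m∉ ∘ inj₁)

above-near : ∀ {k m i j} → ¬ Near k m → Near k i → Near k j → i < m → j < m
above-near {k} {m} m∉ near-i near-j i<m with ℕ.<-cmp m _
... | tri< m<j _ _ = contradiction i<m (ℕ.<-asym (below-near m∉ near-j near-i m<j))
... | tri≈ _ refl _ = contradiction near-j m∉
... | tri> _ _ j<m = j<m

¬between-near : ∀ {k m i j} → Near k i → Near k j → i < m → m < j → ⊥
¬between-near (inj₁ refl) (inj₁ refl) i<m m<j = ℕ.<-asym i<m m<j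
¬between-near (inj₁ refl) (inj₂ refl) i<m m<j = ℕ.<⇒≱ i<m (ℕ.≤-pred m<j)
¬between-near (inj₂ refl) (inj₁ refl) i<m m<j = ℕ.<-asym (ℕ.<-trans i<m m<j) (ℕ.n<1+n _)
¬between-near (inj₂ refl) (inj₂ refl) i<m m<j = ℕ.<-asym i<m m<j

record AdjacentSwap (r r′ : Fin n → ℕ) (x y : Fin n) : Set where
  field
    r-y      : r y ≡ suc (r x)
    r′-x     : r′ x ≡ suc (r x)
    r′-y     : r′ y ≡ r x
    same     : ∀ z → z ≢ x → z ≢ y → r′ z ≡ r z
    distinct : ∀ z → z ≢ x → z ≢ y → ¬ Near (r x) (r z)

module Swap {r r′ : Fin n → ℕ} {x y : Fin n} (adj : AdjacentSwap r r′ x y) where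
  open AdjacentSwap adj

  Pair : Fin n → Set
  Pair z = z ≡ x ⊎ z ≡ y

  pair? : ∀ z → Dec (Pair z)
  pair? z = (z Fin.≟ x) ⊎-dec (z Fin.≟ y)

  off-near : ∀ {z} → ¬ Pair z → ¬ Near (r x) (r z)
  off-near z∉ = distinct _ (z∉ ∘ inj₁) (z∉ ∘ inj₂)

  off-same : ∀ {z} → ¬ Pair z → r′ z ≡ r z
  off-same z∉ = same _ (z∉ ∘ inj₁) (z∉ ∘ inj₂)

  near : ∀ {z} → Pair z → Near (r x) (r z)
  near (inj₁ refl) = inj₁ refl
  near (inj₂ refl) = inj₂ r-y

  near′ : ∀ {z} → Pair z → Near (r x) (r′ z)
  near′ (inj₁ refl) = inj₂ r′-x
  near′ (inj₂ refl) = inj₁ r′-y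

  x≢y : x ≢ y
  x≢y refl = ℕ.1+n≢n (sym r-y)

  -- Composing a labelling with this map lets `cx` and `cy` choose the new blocks of `x` and `y`:
  -- `true` means the old block of `x`, `false` that of `y`.
  relocate : Bool → Bool → Fin n → Fin n
  relocate cx cy z with z Fin.≟ x | z Fin.≟ y
  ... | yes _ | _     = if cx then x else y
  ... | no  _ | yes _ = if cy then x else y
  ... | no  _ | no  _ = z

  relocate-x : ∀ cx cy → relocate cx cy x ≡ (if cx then x else y)
  relocate-x cx cy with x Fin.≟ x
  ... | yes _  = refl
  ... | no x≢x = contradiction refl x≢x

  relocate-y : ∀ cx cy → relocate cx cy y ≡ (if cy then x else y)
  relocate-y cx cy with y Fin.≟ x | y Fin.≟ y
  ... | yes y≡x | _      = contradiction (sym y≡x) x≢y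
  ... | no  _   | yes _  = refl
  ... | no  _   | no y≢y = contradiction refl y≢y

  relocate-off : ∀ cx cy {z} → ¬ Pair z → relocate cx cy z ≡ z
  relocate-off cx cy {z} z∉ with z Fin.≟ x | z Fin.≟ y
  ... | yes z≡x | _       = contradiction (inj₁ z≡x) z∉
  ... | no  _   | yes z≡y = contradiction (inj₂ z≡y) z∉
  ... | no  _   | no  _   = refl

  pair-if : ∀ c → Pair (if c then x else y)
  pair-if true  = inj₁ refl
  pair-if false = inj₂ refl

  relocate-pair : ∀ cx cy {z} → Pair z → Pair (relocate cx cy z)
  relocate-pair cx cy (inj₁ refl) = subst Pair (sym (relocate-x cx cy)) (pair-if cx)
  relocate-pair cx cy (inj₂ refl) = subst Pair (sym (relocate-y cx cy)) (pair-if cy)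

  -- Only the comparison of `y` with `x` could be reversed, as every other element is on the same
  -- side of both. That happens when both stay in place, the case excluded by `ok`.
  relocate-< : ∀ {cx cy} (f : Labelling n) → ¬ (cx ≡ true × cy ≡ false) → ∀ {u v} →
    r′ u < r′ v → f (relocate cx cy u) ≢ f (relocate cx cy v) → r (relocate cx cy u) < r (relocate cx cy v)
  relocate-< {cx} {cy} f ok {u} {v} u<v fu≢fv with pair? u | pair? v
  ... | no u∉ | no v∉ rewrite relocate-off cx cy u∉ | relocate-off cx cy v∉ | off-same u∉ | off-same v∉ = u<v
  ... | no u∉ | yes v∈ rewrite relocate-off cx cy u∉ | off-same u∉ =
    below-near (off-near u∉) (near′ v∈) (near (relocate-pair cx cy v∈)) u<v
  ... | yes u∈ | no v∉ rewrite relocate-off cx cy v∉ | off-same v∉ =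
    above-near (off-near v∉) (near′ u∈) (near (relocate-pair cx cy u∈)) u<v
  ... | yes (inj₁ refl) | yes (inj₁ refl) = contradiction refl fu≢fv
  ... | yes (inj₂ refl) | yes (inj₂ refl) = contradiction refl fu≢fv
  ... | yes (inj₁ refl) | yes (inj₂ refl) rewrite r′-x | r′-y = contradiction u<v (ℕ.<-asym (ℕ.n<1+n (r u)))
  ... | yes (inj₂ refl) | yes (inj₁ refl) rewrite relocate-x cx cy | relocate-y cx cy with cx | cy
  ...   | true  | false = contradiction (refl , refl) ok
  ...   | true  | true  = contradiction refl fu≢fv
  ...   | false | false = contradiction refl fu≢fv
  ...   | false | true  rewrite r-y = ℕ.n<1+n (r x)

  relocate-nonCrossing : ∀ {cx cy} {f : Labelling n} → ¬ (cx ≡ true × cy ≡ false) →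
    NonCrossingBy r f → NonCrossingBy r′ (f ∘ relocate cx cy)
  relocate-nonCrossing {cx} {cy} {f} ok nc a b _ _ ab ba′ a′b′ a≡ b≡ with f (relocate cx cy a) Fin.≟ f (relocate cx cy b)
  ... | yes eq = eq
  ... | no neq = nc _ _ _ _ (relocate-< f ok ab neq)
                    (relocate-< f ok ba′ (λ eq → neq (≡-trans a≡ (sym eq))))
                    (relocate-< f ok a′b′ (λ eq → neq (≡-trans a≡ (≡-trans eq (sym b≡))))) a≡ b≡

  -- The terms of the relation for two adjacent elements

  module Uncross {σ : Labelling n} (σx≢σy : σ x ≢ σ y) (nc : NonCrossingBy r σ) where

    α β : Fin n
    α = σ x
    β = σ y

    data View (z : Fin n) : Fin 4 ⊎ Fin n → Set where
      is-x  : z ≡ x → View z (inj₁ zero)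
      is-y  : z ≡ y → View z (inj₁ (suc zero))
      in-β  : ¬ Pair z → σ z ≡ β → View z (inj₁ (suc (suc zero)))
      in-α  : ¬ Pair z → σ z ≡ α → View z (inj₁ (suc (suc (suc zero))))
      other : ∀ {l} → ¬ Pair z → σ z ≢ α → σ z ≢ β → σ z ≡ l → View z (inj₂ l)

    classify : ∀ z → ∃ (View z)
    classify z with pair? z | σ z Fin.≟ α | σ z Fin.≟ β
    ... | yes (inj₁ z≡x) | _      | _      = _ , is-x z≡x
    ... | yes (inj₂ z≡y) | _      | _      = _ , is-y z≡y
    ... | no z∉          | yes ≡α | _      = _ , in-α z∉ ≡α
    ... | no z∉          | no _   | yes ≡β = _ , in-β z∉ ≡β
    ... | no z∉          | no ≢α  | no ≢β  = _ , other z∉ ≢α ≢β refl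

    P : Fin n → Fin 4 ⊎ Fin n
    P z = proj₁ (classify z)

    P≢α : ∀ z → P z ≢ inj₂ α
    P≢α z eq with subst (View z) eq (proj₂ (classify z))
    ... | other _ ≢α _ ≡α = ≢α ≡α

    P≢β : ∀ z → P z ≢ inj₂ β
    P≢β z eq with subst (View z) eq (proj₂ (classify z))
    ... | other _ _ ≢β ≡β = ≢β ≡β

    open Pieces P α β P≢α P≢β public using (colour; paint; crossing-relation)

    colour-σ : ∀ c → colour c ≡ σ (if c then x else y)
    colour-σ true  = refl
    colour-σ false = refl

    paint-relocate : ∀ cx cy z → paint (colouring cx cy false true) z ≡ σ (relocate cx cy z)
    paint-relocate cx cy z with classify z
    ... | _ , is-x refl rewrite relocate-x cx cy = colour-σ cx
    ... | _ , is-y refl rewrite relocate-y cx cy = colour-σ cy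
    ... | _ , in-β z∉ ≡β rewrite relocate-off cx cy z∉ = sym ≡β
    ... | _ , in-α z∉ ≡α rewrite relocate-off cx cy z∉ = sym ≡α
    ... | _ , other z∉ _ _ ≡l rewrite relocate-off cx cy z∉ = sym ≡l

    Merged : Fin n → Set
    Merged l = l ≡ α ⊎ l ≡ β

    merge : Fin n → Fin n
    merge l with l Fin.≟ β
    ... | yes _ = α
    ... | no  _ = l

    merge-merged : ∀ {l} → Merged l → merge l ≡ α
    merge-merged {l} l∈ with l Fin.≟ β | l∈
    ... | yes _  | _       = refl
    ... | no _   | inj₁ ≡α = ≡α
    ... | no l≢β | inj₂ ≡β = contradiction ≡β l≢β

    merge-kernel : ∀ {k l} → merge k ≡ merge l → k ≡ l ⊎ (Merged k × Merged l)
    merge-kernel {k} {l} eq with k Fin.≟ β | l Fin.≟ β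
    ... | yes k≡β | yes l≡β = inj₂ (inj₂ k≡β , inj₂ l≡β)
    ... | yes k≡β | no  _   = inj₂ (inj₂ k≡β , inj₁ (sym eq))
    ... | no  _   | yes l≡β = inj₂ (inj₁ eq , inj₂ l≡β)
    ... | no  _   | no  _   = inj₁ eq

    merge-pair : ∀ {z} → Pair z → merge (σ z) ≡ α
    merge-pair (inj₁ refl) = merge-merged (inj₁ refl)
    merge-pair (inj₂ refl) = merge-merged (inj₂ refl)

    representative : ∀ {l} → Merged l → ∃ λ z → Pair z × σ z ≡ l
    representative (inj₁ refl) = x , inj₁ refl , refl
    representative (inj₂ refl) = y , inj₂ refl , refl

    -- x and y lie on the same side of every other element, so a chord that
    -- separates the two merged blocks would cross one of them.
    merge-nonCrossing : NonCrossingBy r (merge ∘ σ)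
    merge-nonCrossing a b a′ b′ ab ba′ a′b′ a≡ b≡ with merge-kernel a≡ | merge-kernel b≡
    ... | inj₁ σa≡ | inj₁ σb≡ = cong merge (nc _ _ _ _ ab ba′ a′b′ σa≡ σb≡)
    ... | inj₂ (a∈ , _) | inj₂ (b∈ , _) = ≡-trans (merge-merged a∈) (sym (merge-merged b∈))
    ... | inj₂ (a∈ , a′∈) | inj₁ σb≡ with pair? b | pair? b′
    ...   | yes b∈ | _ = ≡-trans (merge-merged a∈) (sym (merge-pair b∈))
    ...   | _ | yes b′∈ = ≡-trans (merge-merged a∈) (sym (≡-trans b≡ (merge-pair b′∈)))
    -- `u` and `u′` are the elements among `x`, `y` in the blocks of `a` and `a′`. They lie below
    -- `b`, between `b` and `b′`, or above `b′`; each case yields an alternation in `σ`.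
    ...   | no b∉ | no b′∉ with representative a∈ | representative a′∈
    ...     | u , u∈ , σu | u′ , u′∈ , σu′ with ℕ.<-cmp (r u) (r b) | ℕ.<-cmp (r u) (r b′)
    ...       | tri< u<b _ _ | _ = ≡-trans a≡ (cong merge (≡-trans (sym σu′)
                  (nc _ _ _ _ (above-near (off-near b∉) (near u∈) (near u′∈) u<b) ba′ a′b′ σu′ σb≡)))
    ...       | tri> _ _ b<u | tri< u<b′ _ _ = cong merge (nc _ _ _ _ ab b<u u<b′ (sym σu) σb≡)
    ...       | _ | tri> _ _ b′<u = sym (≡-trans (cong merge (nc _ _ _ _ ba′ a′b′
                  (below-near (off-near b′∉) (near u∈) (near u′∈) b′<u) σb≡ (sym σu′))) (sym a≡))
    ...       | tri≈ _ u≡b _ | _ = contradiction (subst (Near (r x)) u≡b (near u∈)) (off-near b∉)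
    ...       | _ | tri≈ _ u≡b′ _ = contradiction (subst (Near (r x)) u≡b′ (near u∈)) (off-near b′∉)
    merge-nonCrossing a b a′ b′ ab ba′ a′b′ a≡ b≡ | inj₁ σa≡ | inj₂ (b∈ , b′∈) with pair? a | pair? a′
    ...   | yes a∈ | _ = ≡-trans (merge-pair a∈) (sym (merge-merged b∈))
    ...   | _ | yes a′∈ = ≡-trans (≡-trans a≡ (merge-pair a′∈)) (sym (merge-merged b∈))
    ...   | no a∉ | no a′∉ with representative b∈ | representative b′∈
    ...     | u , u∈ , σu | u′ , u′∈ , σu′ with ℕ.<-cmp (r u) (r a) | ℕ.<-cmp (r u) (r a′)
    ...       | tri< u<a _ _ | _ = sym (cong merge (≡-trans (sym σu) (nc _ _ _ _ u<a ab ba′ σu σa≡)))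
    ...       | tri> _ _ a<u | tri< u<a′ _ _ = ≡-trans (cong merge (≡-trans
                  (nc _ _ _ _ (below-near (off-near a∉) (near u∈) (near u′∈) a<u)
                      (above-near (off-near a′∉) (near u∈) (near u′∈) u<a′) a′b′ σa≡ σu′) σu′)) (sym b≡)
    ...       | _ | tri> _ _ a′<u = cong merge (nc _ _ _ _ ab ba′ a′<u σa≡ (sym σu))
    ...       | tri≈ _ u≡a _ | _ = contradiction (subst (Near (r x)) u≡a (near u∈)) (off-near a∉)
    ...       | _ | tri≈ _ u≡a′ _ = contradiction (subst (Near (r x)) u≡a′ (near u∈)) (off-near a′∉)

    -- After merging, `x` and `y` share a block, so exchanging them leaves the labelling as it is.
    merge-nonCrossing′ : NonCrossingBy r′ (merge ∘ σ)
    merge-nonCrossing′ = nonCrossingBy-cong r′ swap-invariant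
      (relocate-nonCrossing {false} {true} {merge ∘ σ} (λ ()) merge-nonCrossing)
      where
      swap-invariant : ∀ z → merge (σ (relocate false true z)) ≡ merge (σ z)
      swap-invariant z with pair? z
      ... | yes z∈ = ≡-trans (merge-pair (relocate-pair false true z∈)) (sym (merge-pair z∈))
      ... | no  z∉ = cong (merge ∘ σ) (relocate-off false true z∉)

    colour-merged : ∀ c → Merged (colour c)
    colour-merged true  = inj₁ refl
    colour-merged false = inj₂ refl

    paint-merge : ∀ cx cy z → merge (paint (colouring cx cy true true) z) ≡ merge (σ z)
    paint-merge cx cy z with classify z
    ... | _ , is-x refl = ≡-trans (merge-merged (colour-merged cx)) (sym (merge-pair (inj₁ refl)))
    ... | _ , is-y refl = ≡-trans (merge-merged (colour-merged cy)) (sym (merge-pair (inj₂ refl)))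
    ... | _ , in-β _ ≡β = ≡-trans (merge-merged (inj₁ refl)) (sym (merge-merged (inj₂ ≡β)))
    ... | _ , in-α _ ≡α = ≡-trans (merge-merged (inj₁ refl)) (sym (merge-merged (inj₁ ≡α)))
    ... | _ , other _ _ _ ≡l = cong merge (sym ≡l)

    paint≡β⇒pair : ∀ cx cy {z} → paint (colouring cx cy true true) z ≡ β → Pair z
    paint≡β⇒pair cx cy {z} eq with classify z
    ... | _ , is-x z≡x         = inj₁ z≡x
    ... | _ , is-y z≡y         = inj₂ z≡y
    ... | _ , in-β _ _         = contradiction eq σx≢σy
    ... | _ , in-α _ _         = contradiction eq σx≢σy
    ... | _ , other _ _ ≢β ≡l  = contradiction (≡-trans ≡l eq) ≢β

    -- Merging the two groups gives a non-crossing partition. The group labelled `β` contains at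
    -- most `x` and `y`, and no element lies strictly between these, so splitting it off creates no
    -- crossing.
    paint-nonCrossing : ∀ cx cy → NonCrossingBy r′ (paint (colouring cx cy true true))
    paint-nonCrossing cx cy a b a′ b′ ab ba′ a′b′ a≡ b≡
      with merge-kernel (≡-trans (paint-merge cx cy a)
        (≡-trans (merge-nonCrossing′ a b a′ b′ ab ba′ a′b′ (lift a≡) (lift b≡)) (sym (paint-merge cx cy b))))
      where
      lift : ∀ {u v} → paint (colouring cx cy true true) u ≡ paint (colouring cx cy true true) v → merge (σ u) ≡ merge (σ v)
      lift eq = ≡-trans (sym (paint-merge cx cy _)) (≡-trans (cong merge eq) (paint-merge cx cy _))
    ... | inj₁ eq = eq
    ... | inj₂ (inj₁ a≡α , inj₁ b≡α) = ≡-trans a≡α (sym b≡α)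
    ... | inj₂ (inj₂ a≡β , _) = ⊥-elim (¬between-near
            (near′ (paint≡β⇒pair cx cy a≡β)) (near′ (paint≡β⇒pair cx cy (≡-trans (sym a≡) a≡β))) ab ba′)
    ... | inj₂ (_ , inj₂ b≡β) = ⊥-elim (¬between-near
            (near′ (paint≡β⇒pair cx cy b≡β)) (near′ (paint≡β⇒pair cx cy (≡-trans (sym b≡) b≡β))) ba′ a′b′)

-- Spans of non-crossing rows

row : List (ℚ × Labelling n) → Labelling n → ℚ
row cs ρ = sumℚ (map (λ (c , σ) → c * forest σ ρ) cs)

InSpan : (Fin n → ℕ) → Labelling n → Set
InSpan {n} r π = Σ (List (ℚ × Labelling n)) λ cs → All (NonCrossingBy r ∘ proj₂) cs × (∀ ρ → forest π ρ ≡ row cs ρ)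

scale : ℚ → List (ℚ × Labelling n) → List (ℚ × Labelling n)
scale c = map (Product.map₁ (c *_))

row-scale-++ : ∀ c (ds es : List (ℚ × Labelling n)) ρ → row (scale c ds ++ es) ρ ≡ c * row ds ρ + row es ρ
row-scale-++ c []             es ρ = sym (≡-trans (cong (_+ row es ρ) (ℚ.*-zeroʳ c)) (ℚ.+-identityˡ _))
row-scale-++ c ((d , σ) ∷ ds) es ρ = ≡-trans (cong (c * d * forest σ ρ +_) (row-scale-++ c ds es ρ))
  (solve 5 (λ c d f s t → c :* d :* f :+ (c :* s :+ t) := c :* (d :* f :+ s) :+ t) refl
    c d (forest σ ρ) (row ds ρ) (row es ρ))
  where open +-*-Solver

nonCrossing⇒inSpan : ∀ {r : Fin n → ℕ} {π} → NonCrossingBy r π → InSpan r π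
nonCrossing⇒inSpan {π = π} nc = (1ℚ , π) ∷ [] , nc ∷ [] ,
  λ ρ → sym (≡-trans (ℚ.+-identityʳ _) (ℚ.*-identityˡ _))

span-mono : ∀ {r r′ : Fin n → ℕ} → (∀ {σ} → NonCrossingBy r σ → InSpan r′ σ) → ∀ {π} → InSpan r π → InSpan r′ π
span-mono {n} {r} {r′} step (cs , ncs , eq) with go cs ncs
  where
  go : ∀ cs → All (NonCrossingBy r ∘ proj₂) cs →
    Σ (List (ℚ × Labelling n)) λ ds → All (NonCrossingBy r′ ∘ proj₂) ds × (∀ ρ → row cs ρ ≡ row ds ρ)
  go []             []         = [] , [] , λ ρ → refl
  go ((c , σ) ∷ cs) (nc ∷ ncs) with step {σ} nc | go cs ncs
  ... | ds , nds , σ≡ | es , nes , cs≡ = scale c ds ++ es , All.++⁺ (All.map⁺ nds) nes ,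
    λ ρ → ≡-trans (cong₂ (λ s t → c * s + t) (σ≡ ρ) (cs≡ ρ)) (sym (row-scale-++ c ds es ρ))
... | ds , nds , cs≡ = ds , nds , λ ρ → ≡-trans (eq ρ) (cs≡ ρ)

swap-inSpan : ∀ {r r′ : Fin n → ℕ} {x y} → AdjacentSwap r r′ x y → ∀ {σ} → NonCrossingBy r σ → InSpan r′ σ
swap-inSpan {r = r} {r′} {x} {y} adj {σ} nc with σ x Fin.≟ σ y
... | yes σx≡σy = nonCrossing⇒inSpan {r = r′} (nonCrossingBy-cong r′ invariant
        (relocate-nonCrossing {true} {true} {σ} (λ ()) nc))
  where
  open Swap adj
  invariant : ∀ z → σ (relocate true true z) ≡ σ z
  invariant z with pair? z
  ... | yes (inj₁ refl) = cong σ (relocate-x true true)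
  ... | yes (inj₂ refl) = ≡-trans (cong σ (relocate-y true true)) σx≡σy
  ... | no  z∉          = cong σ (relocate-off true true z∉)
... | no σx≢σy =
    -- The relation is solved for `σ`, which is the term `true false false`. The terms ending in
    -- `false` are relocations, and those ending in `true` come from the merged blocks.
    (- 1ℚ , term false true false) ∷ (- 1ℚ , term false false true) ∷ (- 1ℚ , term true true true) ∷
    (1ℚ , term false true true) ∷ (1ℚ , term true false true) ∷
    (1ℚ , term true true false) ∷ (1ℚ , term false false false) ∷ [] ,
    relocated false true (λ ()) ∷ paint-nonCrossing false false ∷ paint-nonCrossing true true ∷
    paint-nonCrossing false true ∷ paint-nonCrossing true false ∷
    relocated true true (λ ()) ∷ relocated false false (λ ()) ∷ [] ,
    λ ρ → ≡-trans (forest-cong original ρ) (crossing-relation ρ)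
  where
  open Swap adj
  open Uncross {σ} σx≢σy nc
  term : Bool → Bool → Bool → Labelling _
  term cx cy cb = paint (colouring cx cy cb true)
  relocated : ∀ cx cy → ¬ (cx ≡ true × cy ≡ false) → NonCrossingBy r′ (term cx cy false)
  relocated cx cy ok = nonCrossingBy-cong r′ (λ z → sym (paint-relocate cx cy z)) (relocate-nonCrossing {cx} {cy} {σ} ok nc)
  original : ∀ z → σ z ≡ term true false false z
  original z = sym (≡-trans (paint-relocate true false z) (cong σ (unmoved z)))
    where
    unmoved : ∀ z → relocate true false z ≡ z
    unmoved z with pair? z
    ... | yes (inj₁ refl) = relocate-x true false
    ... | yes (inj₂ refl) = relocate-y true false
    ... | no  z∉          = relocate-off true false z∉

-- Orderings as lists and their rearrangement

index : List (Fin n) → Fin n → ℕ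
-- An element that is missing from a list thus gets the length of the list, a position different
-- from those of all its members.
index []       z = 0
index (w ∷ ws) z with z Fin.≟ w
... | yes _ = 0
... | no  _ = suc (index ws z)

index-here : ∀ w (ws : List (Fin n)) → index (w ∷ ws) w ≡ 0
index-here w ws with w Fin.≟ w
... | yes _  = refl
... | no w≢w = contradiction refl w≢w

index-there : ∀ {w z} (ws : List (Fin n)) → z ≢ w → index (w ∷ ws) z ≡ suc (index ws z)
index-there {w = w} {z} ws z≢w with z Fin.≟ w
... | yes z≡w = contradiction z≡w z≢w
... | no  _   = refl

near-suc⁻ : ∀ {k i} → Near (suc k) (suc i) → Near k i
near-suc⁻ = Sum.map ℕ.suc-injective ℕ.suc-injective

index-swap : ∀ p {x y} (s : List (Fin n)) → Unique (p ++ x ∷ y ∷ s) →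
  AdjacentSwap (index (p ++ x ∷ y ∷ s)) (index (p ++ y ∷ x ∷ s)) x y
index-swap [] {x} {y} s ((x≢y ∷ _) ∷ _) = record
  { r-y      = ≡-trans (index-there (y ∷ s) (x≢y ∘ sym)) (cong suc (≡-trans (index-here y s) (sym (index-here x (y ∷ s)))))
  ; r′-x     = ≡-trans (index-there (x ∷ s) x≢y) (cong suc (≡-trans (index-here x s) (sym (index-here x (y ∷ s)))))
  ; r′-y     = ≡-trans (index-here y (x ∷ s)) (sym (index-here x (y ∷ s)))
  ; same     = λ z z≢x z≢y → ≡-trans (skip z≢y z≢x) (sym (skip z≢x z≢y))
  ; distinct = λ z z≢x z≢y → far (index-here x (y ∷ s)) (skip z≢x z≢y)
  }
  where
  skip : ∀ {u v z} → z ≢ u → z ≢ v → index (u ∷ v ∷ s) z ≡ suc (suc (index s z))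
  skip z≢u z≢v = ≡-trans (index-there _ z≢u) (cong suc (index-there s z≢v))
  far : ∀ {k i j} → k ≡ 0 → i ≡ suc (suc j) → ¬ Near k i
  far refl refl (inj₁ ())
  far refl refl (inj₂ ())
index-swap (w ∷ p) {x} {y} s (w≢ ∷ u) = record
  { r-y      = ≡-trans (index-there l y≢w) (cong suc (≡-trans r-y (sym (index-there l x≢w))))
  ; r′-x     = ≡-trans (index-there l′ x≢w) (cong suc (≡-trans r′-x (sym (index-there l x≢w))))
  ; r′-y     = ≡-trans (index-there l′ y≢w) (≡-trans (cong suc r′-y) (sym (index-there l x≢w)))
  ; same     = same′
  ; distinct = distinct′
  }
  where
  l l′ : List (Fin _)
  l  = p ++ x ∷ y ∷ s
  l′ = p ++ y ∷ x ∷ s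
  open AdjacentSwap (index-swap p s u)
  x≢w : x ≢ w
  x≢w = All.lookup w≢ (∈-++⁺ʳ p (here refl)) ∘ sym
  y≢w : y ≢ w
  y≢w = All.lookup w≢ (∈-++⁺ʳ p (there (here refl))) ∘ sym
  same′ : ∀ z → z ≢ x → z ≢ y → index (w ∷ l′) z ≡ index (w ∷ l) z
  same′ z z≢x z≢y with z Fin.≟ w
  ... | yes _ = refl
  ... | no  _ = cong suc (same z z≢x z≢y)
  distinct′ : ∀ z → z ≢ x → z ≢ y → ¬ Near (index (w ∷ l) x) (index (w ∷ l) z)
  distinct′ z z≢x z≢y near rewrite index-there l x≢w with z Fin.≟ w | near
  ... | yes _ | inj₁ ()
  ... | yes _ | inj₂ ()
  ... | no  _ | near′ = distinct z z≢x z≢y (near-suc⁻ near′)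

-- The prefix `p` grows as the derivation of the permutation descends, so that each exchange inside
-- a tail is an adjacent exchange of the whole list.
span-↭ : ∀ p {xs ys : List (Fin n)} → xs ↭ ys → Unique (p ++ xs) → ∀ {π} →
  InSpan (index (p ++ xs)) π → InSpan (index (p ++ ys)) π
span-↭ p refl u sp = sp
span-↭ p (prep {xs} {ys} x q) u {π} sp =
  subst (λ l → InSpan (index l) π) (++-assoc p [ x ] ys)
    (span-↭ (p ++ [ x ]) q (subst Unique (sym (++-assoc p [ x ] xs)) u)
      (subst (λ l → InSpan (index l) π) (sym (++-assoc p [ x ] xs)) sp))
span-↭ p (swap {xs} {ys} x y q) u {π} sp =
  subst (λ l → InSpan (index l) π) (++-assoc p (y ∷ [ x ]) ys)
    (span-↭ (p ++ y ∷ [ x ]) q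
      (subst Unique (sym (++-assoc p (y ∷ [ x ]) xs)) (unique-resp-↭ (++⁺ˡ p (swap x y refl)) u))
      (subst (λ l → InSpan (index l) π) (sym (++-assoc p (y ∷ [ x ]) xs))
        (span-mono {r = index (p ++ x ∷ y ∷ xs)} {r′ = index (p ++ y ∷ x ∷ xs)} (swap-inSpan (index-swap p xs u)) sp)))
span-↭ p (trans q q′) u sp = span-↭ p q′ (unique-resp-↭ (++⁺ˡ p q) u) (span-↭ p q u sp)

index-sorted : ∀ (key : Fin n → ℕ) {l} → AllPairs (λ a b → key a ≤ key b) l → ∀ {a b} → a ∈ l → b ∈ l →
  key a < key b → index l a < index l b
index-sorted key {w ∷ l} (w≤ ∷ ps) {a} {b} a∈ b∈ a<b with a Fin.≟ w | b Fin.≟ w | a∈ | b∈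
... | yes refl | yes refl | _          | _          = contradiction a<b (ℕ.<-irrefl refl)
... | yes refl | no  _    | _          | _          = s≤s z≤n
... | no a≢w   | _        | here a≡w   | _          = contradiction a≡w a≢w
... | no _     | yes refl | there a∈l  | _          = contradiction a<b (ℕ.≤⇒≯ (All.lookup w≤ a∈l))
... | no _     | no b≢w   | there _    | here b≡w   = contradiction b≡w b≢w
... | no _     | no _     | there a∈l  | there b∈l  = s≤s (index-sorted key ps a∈l b∈l a<b)

-- Orderings sorted by a key

module SortedBy (key : Fin n → ℕ) where

  order : DecTotalOrder _ _ _
  order = On.decTotalOrder ℕ.≤-decTotalOrder key

  sorted : List (Fin n)
  sorted = Sort.sort order (allFin n)

  sorted↭ : sorted ↭ allFin n
  sorted↭ = Sort.sort-↭ order (allFin n)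

  index-mono : ∀ {a b} → key a < key b → index sorted a < index sorted b
  index-mono = index-sorted key (Sorted⇒AllPairs (DecTotalOrder.totalOrder order) (Sort.sort-↗ order (allFin n)))
    (∈-resp-↭ (↭-sym sorted↭) (∈-allFin _)) (∈-resp-↭ (↭-sym sorted↭) (∈-allFin _))

  -- The inequality of keys is weak because elements with equal keys, such as those of one block,
  -- may appear in any order.
  index-reflects : ∀ {a b} → index sorted a < index sorted b → key a ≤ key b
  index-reflects a<b = ℕ.≮⇒≥ (ℕ.<-asym a<b ∘ index-mono)

-- Between two elements of a block the labels are squeezed between equal values.
label-sorted-nonCrossing : (π : Labelling n) → NonCrossingBy (index (SortedBy.sorted (toℕ ∘ π))) π
label-sorted-nonCrossing π _ b _ _ ab ba′ _ a≡ _ =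
  Fin.toℕ-injective (ℕ.≤-antisym (index-reflects ab) (subst (λ l → toℕ (π b) ≤ toℕ l) (sym a≡) (index-reflects ba′)))
  where open SortedBy (toℕ ∘ π)

nonCrossingBy⇒NonCrossing : (o : LinearOrder n) → ∀ {f} →
  NonCrossingBy (index (SortedBy.sorted (toℕ ∘ LinearOrder.pos o))) f → NonCrossing o f
nonCrossingBy⇒NonCrossing o nc a₁ a₂ b₁ b₂ a≡ b≡ a≢b =
  [ (λ (p , q , s) → a≢b (nc _ _ _ _ (index-mono p) (index-mono q) (index-mono s) a≡ b≡))
  , (λ (p , q , s) → a≢b (sym (nc _ _ _ _ (index-mono p) (index-mono q) (index-mono s) b≡ a≡))) ]′
  where open SortedBy (toℕ ∘ LinearOrder.pos o)

theorem25 : (n : ℕ) (o : LinearOrder n) (F : Labelling n → Labelling n → ℚ) →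
    IsForestMatrix n F → (π : Labelling n) →
    Σ (List (ℚ × Labelling n)) λ cs →
    All (λ cσ → NonCrossing o (proj₂ cσ)) cs ×
    ((ρ : Labelling n) → F π ρ ≡ sumℚ (map (λ cσ → proj₁ cσ * F (proj₂ cσ) ρ) cs))
-- The rearrangement starts from the list sorted by the labels of `π`, passes through `allFin n`,
-- and ends at the list sorted by the given ordering.
theorem25 n o F isF π with span-↭ [] (↭-trans (sorted↭ (toℕ ∘ π)) (↭-sym (sorted↭ (toℕ ∘ LinearOrder.pos o))))
    (unique-resp-↭ (↭-sym (sorted↭ (toℕ ∘ π))) (allFin⁺ n))
    (nonCrossing⇒inSpan {r = index (sorted (toℕ ∘ π))} (label-sorted-nonCrossing π))
  where open SortedBy
... | cs , ncs , eq = cs , All.map (nonCrossingBy⇒NonCrossing o) ncs , λ ρ →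
    ≡-trans (forestMatrix-unique isF π ρ) (≡-trans (eq ρ)
      (cong sumℚ (map-cong (λ (c , σ) → cong (c *_) (sym (forestMatrix-unique isF σ ρ))) cs)))
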